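{- For primes $p<q$, the independence polynomial of $\varGamma(\mathbb{Z}_{p^2q})$ is $$I(\varGamma(\mathbb{Z}_{p^2q}),x)=(1+x)^{(p-1)(p+q-1)}+(1+x)^{p(q-1)}-(1+x)^{(p-1)(q-1)}+(p-1)x(1+x)^{p(p-1)}.$$
   Context: For a positive integer $n$, the zero divisor graph $\varGamma(\mathbb{Z}_n)$ is the simple undirected graph whose vertices are the non-zero zero divisors of the ring $\mathbb{Z}_n$ of integers modulo $n$ (non-zero $a$ such that $ab=0$ for some non-zero $b$), two distinct vertices $a,b$ being adjacent if and only if $ab=0$ in $\mathbb{Z}_n$. An independent set of a finite graph $G$ is a set of vertices no two of which are adjacent (the empty set included); $\alpha(G)$ is the maximum size of an independent set, and $s_k(G)$ is the number of independent sets of size $k$. The independence polynomial of $G$ is $I(G,x)=\sum_{k=0}^{\alpha(G)} s_k(G)x^k$. -}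

module Defs where

open import Data.Fin.Base using (Fin; toℕ)
open import Data.Fin.Properties using (any?; nonZeroIndex) renaming (_≟_ to _≟ᶠ_)
open import Data.Fin.Subset using (Subset; Lift; inside; outside; ∣_∣)
open import Data.Fin.Subset.Properties using (Lift?)
open import Data.Integer.Base as ℤ using (ℤ; +_; 0ℤ; 1ℤ)
open import Data.List.Base using (List; []; _∷_; _++_; map; filter; length; applyUpTo)
open import Data.List.Extrema.Nat using (max)
open import Data.Nat.Base as ℕ using (ℕ; zero; suc)
open import Data.Nat.DivMod using (_mod_)
open import Data.Nat.Properties as ℕ using (*-comm)
open import Data.Product.Base using (_×_; _,_; ∃)
import Data.Vec.Base as Vec
open import Level using (0ℓ)
open import Relation.Binary.Core using (Rel)
import Relation.Binary.Definitions as B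
open import Relation.Binary.PropositionalEquality using (_≡_; _≢_; refl; sym; trans; cong)
open import Relation.Nullary.Decidable using (¬?; _×-dec_)
open import Relation.Nullary.Negation using (¬_)
open import Relation.Unary using (Pred; Decidable)

------------------------------------------------------------------------
-- Polynomials over ℤ

-- The coefficient list, constant term first. Trailing zeros are allowed, so
-- the equality of polynomials is _≈_ below and not _≡_.
Poly : Set
Poly = List ℤ

coeff : Poly → ℕ → ℤ
coeff []      k       = 0ℤ
coeff (c ∷ f) zero    = c
coeff (c ∷ f) (suc k) = coeff f k

infix 4 _≈_
_≈_ : Rel Poly 0ℓ
f ≈ g = ∀ k → coeff f k ≡ coeff g k

const : ℤ → Poly
const c = c ∷ []

X : Poly
X = 0ℤ ∷ 1ℤ ∷ []

infixl 6 _⊕_ _⊖_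
infixl 7 _⊗_
infixr 8 _^ᴾ_

_⊕_ : Poly → Poly → Poly
[]      ⊕ g       = g
(c ∷ f) ⊕ []      = c ∷ f
(c ∷ f) ⊕ (d ∷ g) = (c ℤ.+ d) ∷ (f ⊕ g)

_⊖_ : Poly → Poly → Poly
f ⊖ g = f ⊕ map ℤ.-_ g

_⊗_ : Poly → Poly → Poly
[]      ⊗ g = []
(c ∷ f) ⊗ g = map (c ℤ.*_) g ⊕ (0ℤ ∷ (f ⊗ g))

_^ᴾ_ : Poly → ℕ → Poly
f ^ᴾ zero  = const 1ℤ
f ^ᴾ suc m = f ⊗ f ^ᴾ m

------------------------------------------------------------------------
-- Finite simple graphs

-- The vertices are those elements of the ambient set Fin size that satisfy
-- Vertex, so size itself need not be the number of vertices.
record Graph : Set₁ where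
  field
    size       : ℕ
    Vertex     : Pred (Fin size) 0ℓ
    vertex?    : Decidable Vertex
    Adj        : Rel (Fin size) 0ℓ
    adj?       : B.Decidable Adj
    adj-vertex : ∀ {a b} → Adj a b → Vertex a × Vertex b
    adj-sym    : B.Symmetric Adj
    adj-irrefl : ∀ {a} → ¬ Adj a a

allSubsets : ∀ n → List (Subset n)
allSubsets zero    = Vec.[] ∷ []
allSubsets (suc n) = map (inside Vec.∷_) (allSubsets n) ++ map (outside Vec.∷_) (allSubsets n)

module _ (G : Graph) where
  open Graph G

  -- Lift P S says that P holds at every element of S.
  Independent : Pred (Subset size) 0ℓ
  Independent S = Lift Vertex S × Lift (λ a → Lift (λ b → ¬ Adj a b) S) S

  independent? : Decidable Independent
  independent? S =
    Lift? vertex? S ×-dec Lift? (λ a → Lift? (λ b → ¬? (adj? a b)) S) S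

  independentSets : List (Subset size)
  independentSets = filter independent? (allSubsets size)

  -- The first argument of max is its value at the empty list, which does not
  -- occur here because the empty set is independent.
  α : ℕ
  α = max 0 (map ∣_∣ independentSets)

  s : ℕ → ℕ
  s k = length (filter (λ S → ∣ S ∣ ℕ.≟ k) independentSets)

  independencePoly : Poly
  independencePoly = applyUpTo (λ k → + s k) (suc α)

------------------------------------------------------------------------
-- The zero divisor graph of ℤₙ

-- ℤₙ is represented by the residues Fin n.
infixl 7 _·_
_·_ : ∀ {n} → Fin n → Fin n → Fin n
_·_ {n} a b = ((toℕ a ℕ.* toℕ b) mod n) {{nonZeroIndex a}}

IsZero : ∀ {n} → Pred (Fin n) 0ℓ
IsZero a = toℕ a ≡ 0

isZero? : ∀ {n} → Decidable (IsZero {n})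
isZero? a = toℕ a ℕ.≟ 0

NonZeroZeroDivisor : ∀ {n} → Pred (Fin n) 0ℓ
NonZeroZeroDivisor a = ¬ IsZero a × ∃ λ b → ¬ IsZero b × IsZero (a · b)

nonZeroZeroDivisor? : ∀ {n} → Decidable (NonZeroZeroDivisor {n})
nonZeroZeroDivisor? a =
  ¬? (isZero? a) ×-dec any? (λ b → ¬? (isZero? b) ×-dec isZero? (a · b))

·-comm : ∀ {n} (a b : Fin n) → a · b ≡ b · a
·-comm {suc n} a b = cong (_mod suc n) (*-comm (toℕ a) (toℕ b))

Γ : ℕ → Graph
Γ n = record
  { size       = n
  ; Vertex     = NonZeroZeroDivisor
  ; vertex?    = nonZeroZeroDivisor?
  ; Adj        = λ a b → (NonZeroZeroDivisor a × NonZeroZeroDivisor b) × a ≢ b × IsZero (a · b)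
  ; adj?       = λ a b → (nonZeroZeroDivisor? a ×-dec nonZeroZeroDivisor? b)
                           ×-dec ¬? (a ≟ᶠ b) ×-dec isZero? (a · b)
  ; adj-vertex = λ (vs , _) → vs
  ; adj-sym    = λ {a} {b} ((va , vb) , a≢b , ab≡0) →
                   (vb , va) , (λ b≡a → a≢b (sym b≡a)) , trans (cong toℕ (·-comm b a)) ab≡0
  ; adj-irrefl = λ (_ , a≢a , _) → a≢a refl
  }

{-# OPTIONS --safe #-}
-- Let N = p²q and let V[d] be the set of vertices a with gcd(a, N) = d, for d ∈ {p, p², q, pq}. Two vertices are
-- adjacent exactly when N divides the product of their gcds, so V[p], V[p²] and V[q] contain no edges, V[p²] and
-- V[q] are completely joined, and V[pq] is a clique joined to V[p] and V[p²] but not to V[q]. An independent set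
-- avoiding V[pq] therefore lies in V[p] ∪ V[q] or in V[p] ∪ V[p²] (in both if it lies in V[p]), and one meeting
-- V[pq] is a single vertex of V[pq] together with a subset of V[q].
module Submission where

open import Defs
open import Data.Fin.Base as Fin using (Fin; toℕ; fromℕ<)
open import Data.Fin.Properties using (any?; toℕ<n; toℕ-fromℕ<) renaming (_≟_ to _≟ᶠ_)
open import Data.Fin.Subset using (Subset; Lift; inside; outside; _∈_) renaming (∣_∣ to card)
open import Data.Fin.Subset.Properties using (Lift?; _∈?_)
open import Data.Integer.Base as ℤ using (ℤ; +_; 0ℤ; 1ℤ)
import Data.Integer.Properties as ℤ
open import Data.List.Base using (List; []; _∷_; _++_; map; filter; length; applyUpTo; upTo; allFin; tabulate)
open import Data.List.Extrema.Nat using (xs≤max)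
open import Data.List.Properties
  using (filter-++; length-++; filter-≐; filter-none; filter-accept; filter-reject; map-tabulate; map-upTo)
import Data.List.Relation.Unary.All as All
import Data.List.Relation.Unary.All.Properties as All
open import Data.Nat.Base using (ℕ; zero; suc; _+_; _*_; _∸_; _^_; _<_; _≤_; z≤n; s≤s; NonZero; nonTrivial⇒n>1)
open import Data.Nat.Combinatorics using (_C_; nCk+nC[k+1]≡[n+1]C[k+1])
open import Data.Nat.Coprimality using (Coprime; coprime-divisor; prime⇒coprime) renaming (sym to coprime-sym)
open import Data.Nat.Divisibility
open import Data.Nat.DivMod using (m%n<n)
open import Data.Nat.Primality using (Prime; euclidsLemma; prime⇒irreducible; prime⇒nonZero; prime⇒nonTrivial)
open import Data.Nat.Properties
open import Data.Product.Base using (_×_; _,_; proj₁; proj₂; ∃)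
open import Data.Sum.Base using (_⊎_; inj₁; inj₂; [_,_]′)
import Data.Vec.Base as Vec
open import Function.Base using (_∘_; id)
open import Level using (Level; 0ℓ)
open import Relation.Binary.PropositionalEquality
open import Relation.Nullary.Decidable using (Dec; yes; no; _×-dec_; _⊎-dec_)
open import Relation.Nullary.Negation using (¬_; contradiction)
open import Relation.Unary using (Pred; Decidable; _∪_; _∩_; ∁; _≐_; _⊆_)
open import Relation.Unary.Properties using (_∪?_; _∩?_; ∁?)

-- The exponents in the theorem are class sizes. `V[p]`, `V[p²]`, `V[q]`, `V[pq]` have (p-1)(q-1),
-- q-1, p(p-1), p-1 elements; so `V[p]` with `V[q]` gives (p-1)(p+q-1) and `V[p]` with `V[p²]` gives
-- p(q-1). In the last term, p-1 counts the choices of the vertex in `V[pq]`, x records that vertex,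
-- and p(p-1) is the size of `V[q]`. No gcd is computed: each class is a pattern of divisibilities,
-- and its size comes from counting multiples below N. The identity is proved one coefficient at a
-- time. Identities that would involve a difference are kept in ℕ as equalities of sums wherever
-- possible, because `∸` truncates; integers enter only when coefficients of polynomials are
-- compared.

private
  variable
    ℓ ℓ₁ ℓ₂ ℓ₃ ℓ₄ : Level
    A : Set ℓ₃
    B : Set ℓ₄
    n : ℕ

-- Counting the elements of a list

count : {P : Pred A ℓ} → Decidable P → List A → ℕ
count P? xs = length (filter P? xs)

module _ {P : Pred A ℓ₁} {Q : Pred A ℓ₂} (P? : Decidable P) (Q? : Decidable Q) where

  count-cong : P ≐ Q → ∀ xs → count P? xs ≡ count Q? xs
  count-cong P≐Q xs = cong length (filter-≐ P? Q? P≐Q xs)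

  -- Inclusion-exclusion with a sum on each side, so that no truncated subtraction arises; the
  -- negative term of the theorem originates here.
  count-∪-∩ : ∀ xs → count (P? ∪? Q?) xs + count (P? ∩? Q?) xs ≡ count P? xs + count Q? xs
  count-∪-∩ [] = refl
  count-∪-∩ (x ∷ xs) with ih ← count-∪-∩ xs | P? x | Q? x
  ... | yes _ | yes _ = cong suc (trans (+-suc _ _) (trans (cong suc ih) (sym (+-suc _ _))))
  ... | yes _ | no  _ = cong suc ih
  ... | no  _ | yes _ = trans (cong suc ih) (sym (+-suc _ _))
  ... | no  _ | no  _ = ih

  count-∩-∁ : ∀ xs → count P? xs ≡ count (P? ∩? Q?) xs + count (P? ∩? ∁? Q?) xs
  count-∩-∁ [] = refl
  count-∩-∁ (x ∷ xs) with ih ← count-∩-∁ xs | P? x | Q? x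
  ... | yes _ | yes _ = cong suc ih
  ... | yes _ | no  _ = trans (cong suc ih) (sym (+-suc _ _))
  ... | no  _ | yes _ = ih
  ... | no  _ | no  _ = ih

  count-filter : ∀ xs → count Q? (filter P? xs) ≡ count (P? ∩? Q?) xs
  count-filter [] = refl
  count-filter (x ∷ xs) with P? x
  ... | no  _ = count-filter xs
  ... | yes _ with Q? x
  ...   | yes _ = cong suc (count-filter xs)
  ...   | no  _ = count-filter xs

module _ {P : Pred A ℓ₁} (P? : Decidable P) where

  count-none : (∀ x → ¬ P x) → ∀ xs → count P? xs ≡ 0
  count-none ¬P xs = cong length (filter-none P? (All.universal ¬P xs))

  count-++ : ∀ xs ys → count P? (xs ++ ys) ≡ count P? xs + count P? ys
  count-++ xs ys = trans (cong length (filter-++ P? xs ys)) (length-++ (filter P? xs))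

  count-map : (f : B → A) → ∀ xs → count P? (map f xs) ≡ count (P? ∘ f) xs
  count-map f [] = refl
  count-map f (x ∷ xs) with P? (f x)
  ... | yes _ = cong suc (count-map f xs)
  ... | no  _ = count-map f xs

count-disjoint-∪ : {P : Pred A ℓ₁} {Q : Pred A ℓ₂} (P? : Decidable P) (Q? : Decidable Q) →
  (∀ x → P x → ¬ Q x) → ∀ xs → count (P? ∪? Q?) xs ≡ count P? xs + count Q? xs
count-disjoint-∪ P? Q? disjoint xs = begin
  count (P? ∪? Q?) xs                        ≡⟨ +-identityʳ _ ⟨
  count (P? ∪? Q?) xs + 0                    ≡⟨ cong (_+_ (count (P? ∪? Q?) xs)) none ⟨
  count (P? ∪? Q?) xs + count (P? ∩? Q?) xs  ≡⟨ count-∪-∩ P? Q? xs ⟩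
  count P? xs + count Q? xs                  ∎
  where
  open ≡-Reasoning
  none = count-none (P? ∩? Q?) (λ x (Px , Qx) → disjoint x Px Qx) xs

-- Counting subsets by size

-- The conjunction has the membership condition first and the size second, as results from fusing
-- the two nested filters in `s`.
countSets : {F : Pred (Subset n) ℓ} → Decidable F → ℕ → ℕ
countSets {n = n} F? k = count (F? ∩? λ S → card S ≟ k) (allSubsets n)

module _ {F : Pred (Subset n) ℓ₁} {G : Pred (Subset n) ℓ₂} (F? : Decidable F) (G? : Decidable G) where

  countSets-cong : F ≐ G → ∀ k → countSets F? k ≡ countSets G? k
  countSets-cong (F⊆G , G⊆F) k = count-cong _ _
    ((λ (f , e) → F⊆G f , e) , (λ (g , e) → G⊆F g , e)) (allSubsets n)

  countSets-∪-∩ : ∀ k → countSets (F? ∪? G?) k + countSets (F? ∩? G?) k ≡ countSets F? k + countSets G? k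
  countSets-∪-∩ k = trans
    (cong₂ _+_
      (count-cong ((F? ∪? G?) ∩? size?) ((F? ∩? size?) ∪? (G? ∩? size?))
        ( (λ { (inj₁ f , e) → inj₁ (f , e) ; (inj₂ g , e) → inj₂ (g , e) })
        , (λ { (inj₁ (f , e)) → inj₁ f , e ; (inj₂ (g , e)) → inj₂ g , e })) subsets)
      (count-cong ((F? ∩? G?) ∩? size?) ((F? ∩? size?) ∩? (G? ∩? size?))
        ((λ ((f , g) , e) → (f , e) , (g , e)) , (λ ((f , e) , (g , _)) → (f , g) , e)) subsets))
    (count-∪-∩ (F? ∩? size?) (G? ∩? size?) subsets)
    where
    size? : Decidable (λ (S : Subset n) → card S ≡ k)
    size? S = card S ≟ k
    subsets = allSubsets n

countSets-none : {F : Pred (Subset n) ℓ} (F? : Decidable F) → (∀ S → ¬ F S) → ∀ k → countSets F? k ≡ 0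
countSets-none {n = n} F? ¬F k =
  count-none (F? ∩? λ S → card S ≟ k) (λ S (f , _) → ¬F S f) (allSubsets n)

countSets-disjoint-∪ : {F : Pred (Subset n) ℓ₁} {G : Pred (Subset n) ℓ₂} (F? : Decidable F) (G? : Decidable G) →
  (∀ S → F S → ¬ G S) → ∀ k → countSets (F? ∪? G?) k ≡ countSets F? k + countSets G? k
countSets-disjoint-∪ F? G? disjoint k = begin
  countSets (F? ∪? G?) k                           ≡⟨ +-identityʳ _ ⟨
  countSets (F? ∪? G?) k + 0                       ≡⟨ cong (_+_ (countSets (F? ∪? G?) k)) none ⟨
  countSets (F? ∪? G?) k + countSets (F? ∩? G?) k  ≡⟨ countSets-∪-∩ F? G? k ⟩
  countSets F? k + countSets G? k                  ∎
  where
  open ≡-Reasoning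
  none = countSets-none (F? ∩? G?) (λ S (f , g) → disjoint S f g) k

module _ {F : Pred (Subset (suc n)) ℓ} (F? : Decidable F) where

  private
    -- The first summand is not yet a `countSets`: its size test is `suc (card S) ≟ k`, which fails
    -- for k = 0 and becomes the test at the predecessor otherwise.
    countSets-split : ∀ k → countSets F? k ≡
      count (λ S → (F? (inside Vec.∷ S)) ×-dec (suc (card S) ≟ k)) (allSubsets n)
        + countSets (F? ∘ (outside Vec.∷_)) k
    countSets-split k = trans
      (count-++ _ (map (inside Vec.∷_) (allSubsets n)) _)
      (cong₂ _+_ (count-map _ _ (allSubsets n)) (count-map _ _ (allSubsets n)))

  countSets-zero : countSets F? 0 ≡ countSets (F? ∘ (outside Vec.∷_)) 0
  countSets-zero = trans (countSets-split 0)
    (cong (_+ countSets (F? ∘ (outside Vec.∷_)) 0) (count-none _ (λ _ ()) (allSubsets n)))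

  countSets-suc : ∀ k → countSets F? (suc k) ≡
    countSets (F? ∘ (inside Vec.∷_)) k + countSets (F? ∘ (outside Vec.∷_)) (suc k)
  countSets-suc k = trans (countSets-split (suc k))
    (cong (_+ countSets (F? ∘ (outside Vec.∷_)) (suc k))
      (count-cong _ _ ((λ (f , e) → f , suc-injective e) , (λ (f , e) → f , cong suc e)) (allSubsets n)))

-- Subsets of a fixed set

module _ {Q : Pred (Fin (suc n)) ℓ} where

  Lift-outside : Lift Q ∘ (outside Vec.∷_) ≐ Lift (Q ∘ Fin.suc)
  Lift-outside = (λ l x∈S → l (Vec.there x∈S)) , λ { l (Vec.there x∈S) → l x∈S }

  Lift-inside : Q Fin.zero → Lift Q ∘ (inside Vec.∷_) ≐ Lift (Q ∘ Fin.suc)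
  Lift-inside Q₀ = (λ l x∈S → l (Vec.there x∈S)) ,
    λ { l Vec.here → Q₀ ; l (Vec.there x∈S) → l x∈S }

module _ {Q : Pred (Fin (suc n)) ℓ} (Q? : Decidable Q) where

  private
    count-suc : count Q? (tabulate Fin.suc) ≡ count (Q? ∘ Fin.suc) (allFin n)
    count-suc = trans (cong (count Q?) (sym (map-tabulate id Fin.suc))) (count-map Q? Fin.suc (allFin n))

  count-allFin-accept : Q Fin.zero → count Q? (allFin (suc n)) ≡ suc (count (Q? ∘ Fin.suc) (allFin n))
  count-allFin-accept Q₀ = trans (cong length (filter-accept Q? Q₀)) (cong suc count-suc)

  count-allFin-reject : ¬ Q Fin.zero → count Q? (allFin (suc n)) ≡ count (Q? ∘ Fin.suc) (allFin n)
  count-allFin-reject ¬Q₀ = trans (cong length (filter-reject Q? ¬Q₀)) count-suc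

-- Splitting on whether the first point belongs to the subset reproduces Pascal's rule when that
-- point lies in `Q`, and leaves only the outside half when it does not.
countSets-Lift : {Q : Pred (Fin n) ℓ} (Q? : Decidable Q) →
  ∀ k → countSets (Lift? Q?) k ≡ count Q? (allFin n) C k
countSets-Lift {n = zero}  Q? zero    = refl
countSets-Lift {n = zero}  Q? (suc k) = refl
countSets-Lift {n = suc n} {Q = Q} Q? k = go k (Q? Fin.zero)
  where
  open ≡-Reasoning
  Q′? = Q? ∘ Fin.suc
  m = count Q′? (allFin n)
  inside? = Lift? Q? ∘ (inside Vec.∷_)

  countSets-out : ∀ k → countSets (Lift? Q? ∘ (outside Vec.∷_)) k ≡ m C k
  countSets-out k = trans (countSets-cong (Lift? Q? ∘ (outside Vec.∷_)) (Lift? Q′?) Lift-outside k) (countSets-Lift Q′? k)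

  go : ∀ k → Dec (Q Fin.zero) → countSets (Lift? Q?) k ≡ count Q? (allFin (suc n)) C k
  -- Any `m C 0` reduces to 1, so it does not matter here whether the first point lies in `Q`.
  go zero _ = trans (countSets-zero (Lift? Q?)) (countSets-out 0)
  go (suc k) (yes Q₀) = begin
    countSets (Lift? Q?) (suc k)           ≡⟨ countSets-suc (Lift? Q?) k ⟩
    _                                      ≡⟨ cong₂ _+_ (countSets-cong inside? (Lift? Q′?) (Lift-inside Q₀) k) (countSets-out (suc k)) ⟩
    countSets (Lift? Q′?) k + m C suc k    ≡⟨ cong (_+ m C suc k) (countSets-Lift Q′? k) ⟩
    m C k + m C suc k                      ≡⟨ nCk+nC[k+1]≡[n+1]C[k+1] m k ⟩
    suc m C suc k                          ≡⟨ cong (_C suc k) (count-allFin-accept Q? Q₀) ⟨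
    count Q? (allFin (suc n)) C suc k      ∎
  go (suc k) (no ¬Q₀) = begin
    countSets (Lift? Q?) (suc k)           ≡⟨ countSets-suc (Lift? Q?) k ⟩
    _                                      ≡⟨ cong₂ _+_ (countSets-none inside? (λ S l → ¬Q₀ (l Vec.here)) k) (countSets-out (suc k)) ⟩
    m C suc k                              ≡⟨ cong (_C suc k) (count-allFin-reject Q? ¬Q₀) ⟨
    count Q? (allFin (suc n)) C suc k      ∎

-- Subsets with one element in P and all others in Q

-- Uniqueness of the centre `c` is not demanded; it follows when `P` and `Q` are disjoint, since any
-- other element of `S` lies in `Q`.
OneIn : Pred (Fin n) ℓ₁ → Pred (Fin n) ℓ₂ → Pred (Subset n) _
OneIn P Q S = ∃ λ c → c ∈ S × P c × Lift (λ x → x ≡ c ⊎ Q x) S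

oneIn? : {P : Pred (Fin n) ℓ₁} {Q : Pred (Fin n) ℓ₂} → Decidable P → Decidable Q → Decidable (OneIn P Q)
oneIn? P? Q? S = any? λ c → c ∈? S ×-dec P? c ×-dec Lift? (λ x → x ≟ᶠ c ⊎-dec Q? x) S

module _ {P : Pred (Fin (suc n)) ℓ₁} {Q : Pred (Fin (suc n)) ℓ₂} where

  private
    P′ = P ∘ Fin.suc
    Q′ = Q ∘ Fin.suc

  OneIn-outside : OneIn P Q ∘ (outside Vec.∷_) ≐ OneIn P′ Q′
  OneIn-outside =
    (λ { (Fin.suc c , Vec.there c∈S , Pc , l) → c , c∈S , Pc , λ x∈S → drop-suc (l (Vec.there x∈S)) }) ,
    (λ { (c , c∈S , Pc , l) → Fin.suc c , Vec.there c∈S , Pc , λ { (Vec.there x∈S) → add-suc (l x∈S) } })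
    where
    drop-suc : ∀ {x c} → Fin.suc x ≡ Fin.suc c ⊎ Q (Fin.suc x) → x ≡ c ⊎ Q′ x
    drop-suc (inj₁ refl) = inj₁ refl
    drop-suc (inj₂ Qx)   = inj₂ Qx
    add-suc : ∀ {x c} → x ≡ c ⊎ Q′ x → Fin.suc x ≡ Fin.suc c ⊎ Q (Fin.suc x)
    add-suc (inj₁ refl) = inj₁ refl
    add-suc (inj₂ Qx)   = inj₂ Qx

  -- Such a first point cannot be the centre, so adding or deleting it keeps the centre in the tail.
  OneIn-inside-Q : Q Fin.zero → ¬ P Fin.zero → OneIn P Q ∘ (inside Vec.∷_) ≐ OneIn P′ Q′
  OneIn-inside-Q Q₀ ¬P₀ =
    (λ { (Fin.zero , _ , P₀ , _) → contradiction P₀ ¬P₀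
       ; (Fin.suc c , Vec.there c∈S , Pc , l) → proj₁ OneIn-outside
           (Fin.suc c , Vec.there c∈S , Pc , λ { (Vec.there x∈S) → l (Vec.there x∈S) }) }) ,
    fill ∘ proj₂ OneIn-outside
    where
    fill : ∀ {S} → OneIn P Q (outside Vec.∷ S) → OneIn P Q (inside Vec.∷ S)
    fill (Fin.suc c , Vec.there c∈S , Pc , l) = Fin.suc c , Vec.there c∈S , Pc ,
      λ { Vec.here → inj₂ Q₀ ; (Vec.there x∈S) → l (Vec.there x∈S) }

  -- Here the first point must be the centre: with a centre in the tail it would have to lie in `Q`.
  OneIn-inside-P : P Fin.zero → ¬ Q Fin.zero → OneIn P Q ∘ (inside Vec.∷_) ≐ Lift Q′
  OneIn-inside-P P₀ ¬Q₀ = to , λ l → Fin.zero , Vec.here , P₀ ,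
    λ { Vec.here → inj₁ refl ; (Vec.there x∈S) → inj₂ (l x∈S) }
    where
    to : OneIn P Q ∘ (inside Vec.∷_) ⊆ Lift Q′
    to (Fin.zero , _ , _ , l) x∈S with l (Vec.there x∈S)
    ... | inj₂ Qx = Qx
    to (Fin.suc c , _ , _ , l) x∈S with l Vec.here
    ... | inj₂ Q₀ = contradiction Q₀ ¬Q₀

  ¬OneIn-inside : ¬ P Fin.zero → ¬ Q Fin.zero → ∀ S → ¬ OneIn P Q (inside Vec.∷ S)
  ¬OneIn-inside ¬P₀ ¬Q₀ S (Fin.zero , _ , P₀ , _) = ¬P₀ P₀
  ¬OneIn-inside ¬P₀ ¬Q₀ S (Fin.suc c , _ , _ , l) with l Vec.here
  ... | inj₂ Q₀ = ¬Q₀ Q₀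

countSets-OneIn-zero : {P : Pred (Fin n) ℓ₁} {Q : Pred (Fin n) ℓ₂} (P? : Decidable P) (Q? : Decidable Q) →
  countSets (oneIn? P? Q?) 0 ≡ 0
countSets-OneIn-zero {n = zero}  P? Q? = refl
countSets-OneIn-zero {n = suc n} P? Q? = trans (countSets-zero (oneIn? P? Q?))
  (trans (countSets-cong (oneIn? P? Q? ∘ (outside Vec.∷_)) (oneIn? (P? ∘ Fin.suc) (Q? ∘ Fin.suc)) OneIn-outside 0)
    (countSets-OneIn-zero (P? ∘ Fin.suc) (Q? ∘ Fin.suc)))

-- By disjointness a set determines its centre, so a choice of centre and a choice of k further
-- elements from `Q` are independent. In the induction a first point in `P` raises the first factor
-- by one, and a first point in `Q` raises the upper index of the binomial.
countSets-OneIn-suc : {P : Pred (Fin n) ℓ₁} {Q : Pred (Fin n) ℓ₂} (P? : Decidable P) (Q? : Decidable Q) →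
  (∀ x → P x → ¬ Q x) → ∀ k →
  countSets (oneIn? P? Q?) (suc k) ≡ count P? (allFin n) * (count Q? (allFin n) C k)
countSets-OneIn-suc {n = zero}  P? Q? disjoint k = refl
countSets-OneIn-suc {n = suc n} {P = P} {Q = Q} P? Q? disjoint k = go (P? Fin.zero) (Q? Fin.zero)
  where
  open ≡-Reasoning
  P′? = P? ∘ Fin.suc
  Q′? = Q? ∘ Fin.suc
  r = count P′? (allFin n)
  m = count Q′? (allFin n)
  inside? = oneIn? P? Q? ∘ (inside Vec.∷_)

  ih : ∀ k → countSets (oneIn? P′? Q′?) (suc k) ≡ r * (m C k)
  ih = countSets-OneIn-suc P′? Q′? (disjoint ∘ Fin.suc)

  countSets-out : countSets (oneIn? P? Q? ∘ (outside Vec.∷_)) (suc k) ≡ r * (m C k)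
  countSets-out = trans (countSets-cong (oneIn? P? Q? ∘ (outside Vec.∷_)) (oneIn? P′? Q′?) OneIn-outside (suc k)) (ih k)

  -- Pascal's rule scaled by `r`. The case 0 is separate because `ih` speaks of nonempty sets only;
  -- the empty set has no centre and contributes nothing.
  pascal : ∀ k → countSets (oneIn? P′? Q′?) k + r * (m C k) ≡ r * (suc m C k)
  pascal zero    = cong (_+ r * 1) (countSets-OneIn-zero P′? Q′?)
  pascal (suc k) = begin
    countSets (oneIn? P′? Q′?) (suc k) + r * (m C suc k)  ≡⟨ cong (_+ r * (m C suc k)) (ih k) ⟩
    r * (m C k) + r * (m C suc k)                         ≡⟨ *-distribˡ-+ r (m C k) (m C suc k) ⟨
    r * (m C k + m C suc k)                               ≡⟨ cong (r *_) (nCk+nC[k+1]≡[n+1]C[k+1] m k) ⟩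
    r * (suc m C suc k)                                   ∎

  go : Dec (P Fin.zero) → Dec (Q Fin.zero) →
    countSets (oneIn? P? Q?) (suc k) ≡ count P? (allFin (suc n)) * (count Q? (allFin (suc n)) C k)
  go (yes P₀) (yes Q₀) = contradiction Q₀ (disjoint Fin.zero P₀)
  go (yes P₀) (no ¬Q₀) = begin
    countSets (oneIn? P? Q?) (suc k)                   ≡⟨ countSets-suc (oneIn? P? Q?) k ⟩
    _                                                  ≡⟨ cong₂ _+_ (countSets-cong inside? (Lift? Q′?) (OneIn-inside-P P₀ ¬Q₀) k) countSets-out ⟩
    countSets (Lift? Q′?) k + r * (m C k)              ≡⟨ cong (_+ r * (m C k)) (countSets-Lift Q′? k) ⟩
    suc r * (m C k)                                    ≡⟨ cong₂ (λ x y → x * (y C k)) (count-allFin-accept P? P₀) (count-allFin-reject Q? ¬Q₀) ⟨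
    _                                                  ∎
  go (no ¬P₀) (no ¬Q₀) = begin
    countSets (oneIn? P? Q?) (suc k)                   ≡⟨ countSets-suc (oneIn? P? Q?) k ⟩
    _                                                  ≡⟨ cong₂ _+_ (countSets-none inside? (¬OneIn-inside ¬P₀ ¬Q₀) k) countSets-out ⟩
    r * (m C k)                                        ≡⟨ cong₂ (λ x y → x * (y C k)) (count-allFin-reject P? ¬P₀) (count-allFin-reject Q? ¬Q₀) ⟨
    _                                                  ∎
  go (no ¬P₀) (yes Q₀) = begin
    countSets (oneIn? P? Q?) (suc k)                   ≡⟨ countSets-suc (oneIn? P? Q?) k ⟩
    _                                                  ≡⟨ cong₂ _+_ (countSets-cong inside? (oneIn? P′? Q′?) (OneIn-inside-Q Q₀ ¬P₀) k) countSets-out ⟩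
    countSets (oneIn? P′? Q′?) k + r * (m C k)         ≡⟨ pascal k ⟩
    r * (suc m C k)                                    ≡⟨ cong₂ (λ x y → x * (y C k)) (count-allFin-reject P? ¬P₀) (count-allFin-accept Q? Q₀) ⟨
    _                                                  ∎

-- Coefficients of polynomials

coeff-⊕ : ∀ f g k → coeff (f ⊕ g) k ≡ coeff f k ℤ.+ coeff g k
coeff-⊕ []      g       k       = sym (ℤ.+-identityˡ (coeff g k))
coeff-⊕ (c ∷ f) []      k       = sym (ℤ.+-identityʳ (coeff (c ∷ f) k))
coeff-⊕ (c ∷ f) (d ∷ g) zero    = refl
coeff-⊕ (c ∷ f) (d ∷ g) (suc k) = coeff-⊕ f g k

coeff-map : (h : ℤ → ℤ) → h 0ℤ ≡ 0ℤ → ∀ f k → coeff (map h f) k ≡ h (coeff f k)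
coeff-map h h0≡0 []      k       = sym h0≡0
coeff-map h h0≡0 (c ∷ f) zero    = refl
coeff-map h h0≡0 (c ∷ f) (suc k) = coeff-map h h0≡0 f k

coeff-⊖ : ∀ f g k → coeff (f ⊖ g) k ≡ coeff f k ℤ.- coeff g k
coeff-⊖ f g k = trans (coeff-⊕ f _ k) (cong (ℤ._+_ (coeff f k)) (coeff-map ℤ.-_ refl g k))

coeff-∷-⊗-zero : ∀ c f g → coeff ((c ∷ f) ⊗ g) 0 ≡ c ℤ.* coeff g 0
coeff-∷-⊗-zero c f g = begin
  coeff ((c ∷ f) ⊗ g) 0                ≡⟨ coeff-⊕ (map (c ℤ.*_) g) (0ℤ ∷ f ⊗ g) 0 ⟩
  coeff (map (c ℤ.*_) g) 0 ℤ.+ 0ℤ      ≡⟨ ℤ.+-identityʳ _ ⟩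
  coeff (map (c ℤ.*_) g) 0             ≡⟨ coeff-map (c ℤ.*_) (ℤ.*-zeroʳ c) g 0 ⟩
  c ℤ.* coeff g 0                      ∎
  where open ≡-Reasoning

coeff-∷-⊗-suc : ∀ c f g k → coeff ((c ∷ f) ⊗ g) (suc k) ≡ c ℤ.* coeff g (suc k) ℤ.+ coeff (f ⊗ g) k
coeff-∷-⊗-suc c f g k = trans
  (coeff-⊕ (map (c ℤ.*_) g) (0ℤ ∷ f ⊗ g) (suc k))
  (cong (ℤ._+ coeff (f ⊗ g) k) (coeff-map (c ℤ.*_) (ℤ.*-zeroʳ c) g (suc k)))

coeff-[c]⊗ : ∀ c g k → coeff ((c ∷ []) ⊗ g) k ≡ c ℤ.* coeff g k
coeff-[c]⊗ c g zero    = coeff-∷-⊗-zero c [] g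
coeff-[c]⊗ c g (suc k) = trans (coeff-∷-⊗-suc c [] g k) (ℤ.+-identityʳ _)

-- `const 1ℤ ⊕ X` reduces to `1ℤ ∷ 1ℤ ∷ []`, and multiplying by it adds neighbouring coefficients,
-- which is Pascal's rule again.
coeff-[1+X]^ : ∀ m k → coeff ((const 1ℤ ⊕ X) ^ᴾ m) k ≡ + (m C k)
coeff-[1+X]^ zero    zero    = refl
coeff-[1+X]^ zero    (suc k) = refl
coeff-[1+X]^ (suc m) zero    = trans
  (coeff-∷-⊗-zero 1ℤ (1ℤ ∷ []) ((const 1ℤ ⊕ X) ^ᴾ m))
  (cong (1ℤ ℤ.*_) (coeff-[1+X]^ m 0))
coeff-[1+X]^ (suc m) (suc k) = begin
  coeff (Y ⊗ Y ^ᴾ m) (suc k)                                   ≡⟨ coeff-∷-⊗-suc 1ℤ (1ℤ ∷ []) (Y ^ᴾ m) k ⟩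
  1ℤ ℤ.* coeff (Y ^ᴾ m) (suc k) ℤ.+ coeff ((1ℤ ∷ []) ⊗ Y ^ᴾ m) k
    ≡⟨ cong₂ ℤ._+_ (ℤ.*-identityˡ (coeff (Y ^ᴾ m) (suc k))) (trans (coeff-[c]⊗ 1ℤ (Y ^ᴾ m) k) (ℤ.*-identityˡ _)) ⟩
  coeff (Y ^ᴾ m) (suc k) ℤ.+ coeff (Y ^ᴾ m) k                  ≡⟨ cong₂ ℤ._+_ (coeff-[1+X]^ m (suc k)) (coeff-[1+X]^ m k) ⟩
  + (m C suc k + m C k)                                        ≡⟨ cong +_ (+-comm (m C suc k) (m C k)) ⟩
  + (m C k + m C suc k)                                        ≡⟨ cong +_ (nCk+nC[k+1]≡[n+1]C[k+1] m k) ⟩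
  + (suc m C suc k)                                            ∎
  where
  open ≡-Reasoning
  Y = const 1ℤ ⊕ X

module _ (c : ℤ) (g : Poly) where

  private
    -- const c ⊗ X reduces to c₀ ∷ c₁ ∷ [].
    c₀ = c ℤ.* 0ℤ ℤ.+ 0ℤ
    c₁ = c ℤ.* 1ℤ

    c₀*≡0 : ∀ x → c₀ ℤ.* x ≡ 0ℤ
    c₀*≡0 x = trans (cong (ℤ._* x) (trans (ℤ.+-identityʳ _) (ℤ.*-zeroʳ c))) (ℤ.*-zeroˡ x)

  coeff-cX⊗-zero : coeff (const c ⊗ X ⊗ g) 0 ≡ 0ℤ
  coeff-cX⊗-zero = trans (coeff-∷-⊗-zero c₀ (c₁ ∷ []) g) (c₀*≡0 (coeff g 0))

  coeff-cX⊗-suc : ∀ k → coeff (const c ⊗ X ⊗ g) (suc k) ≡ c ℤ.* coeff g k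
  coeff-cX⊗-suc k = begin
    coeff (const c ⊗ X ⊗ g) (suc k)                        ≡⟨ coeff-∷-⊗-suc c₀ (c₁ ∷ []) g k ⟩
    c₀ ℤ.* coeff g (suc k) ℤ.+ coeff ((c₁ ∷ []) ⊗ g) k     ≡⟨ cong₂ ℤ._+_ (c₀*≡0 (coeff g (suc k))) (coeff-[c]⊗ c₁ g k) ⟩
    0ℤ ℤ.+ c₁ ℤ.* coeff g k                                ≡⟨ ℤ.+-identityˡ _ ⟩
    c₁ ℤ.* coeff g k                                       ≡⟨ cong (ℤ._* coeff g k) (ℤ.*-identityʳ c) ⟩
    c ℤ.* coeff g k                                        ∎
    where open ≡-Reasoning

coeff-applyUpTo : (f : ℕ → ℤ) → ∀ m → (∀ k → m ≤ k → f k ≡ 0ℤ) → ∀ k → coeff (applyUpTo f m) k ≡ f k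
coeff-applyUpTo f zero    f≡0 k       = sym (f≡0 k z≤n)
coeff-applyUpTo f (suc m) f≡0 zero    = refl
coeff-applyUpTo f (suc m) f≡0 (suc k) = coeff-applyUpTo (f ∘ suc) m (λ k m≤k → f≡0 (suc k) (s≤s m≤k)) k

-- Coefficients of the independence polynomial

module _ (G : Graph) where

  s-vanishes : ∀ k → α G < k → s G k ≡ 0
  s-vanishes k α<k = cong length (filter-none (λ S → card S ≟ k)
    (All.map (λ S≤α S≡k → <-irrefl S≡k (≤-<-trans S≤α α<k))
      (All.map⁻ (xs≤max 0 (map card (independentSets G))))))

  -- The coefficient list ends at index `α G`, but `s` vanishes beyond it; hence coefficients can be
  -- compared at every k without computing `α G`.
  coeff-independencePoly : ∀ k → coeff (independencePoly G) k ≡ + s G k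
  coeff-independencePoly = coeff-applyUpTo (λ k → + s G k) (suc (α G)) (λ k α<k → cong +_ (s-vanishes k α<k))

  s≡countSets : ∀ k → s G k ≡ countSets (independent? G) k
  s≡countSets k = count-filter (independent? G) (λ S → card S ≟ k) (allSubsets (Graph.size G))

-- Coprimality and divisibility

-- A common divisor of the product and `c` is coprime to `a`, because its own divisors divide `c`;
-- it therefore divides `b`.
coprime-* : ∀ {a b c} → Coprime a c → Coprime b c → Coprime (a * b) c
coprime-* {a} ac bc {d} (d∣ab , d∣c) = bc (coprime-divisor da d∣ab , d∣c)
  where
  da : Coprime d a
  da (e∣d , e∣a) = ac (e∣a , ∣-trans e∣d d∣c)

coprime-^ : ∀ {a c} m → Coprime a c → Coprime (a ^ m) c
coprime-^ zero    ac (d∣1 , _) = ∣1⇒≡1 d∣1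
coprime-^ (suc m) ac = coprime-* ac (coprime-^ m ac)

coprime-*-∣ : ∀ {d e x} → Coprime d e → d ∣ x → e ∣ x → d * e ∣ x
coprime-*-∣ {d} {e} de d∣x (divides-refl c) =
  *-monoˡ-∣ e (coprime-divisor de (subst (d ∣_) (*-comm c e) d∣x))

prime∤⇒coprime : ∀ {p x} → Prime p → p ∤ x → Coprime p x
prime∤⇒coprime pp p∤x (d∣p , d∣x) with prime⇒irreducible pp d∣p
... | inj₁ d≡1  = d≡1
... | inj₂ refl = contradiction d∣x p∤x

prime-∤-* : ∀ {p} → Prime p → ∀ {x y} → p ∤ x → p ∤ y → p ∤ x * y
prime-∤-* pp {x} {y} p∤x p∤y p∣xy = [ p∤x , p∤y ]′ (euclidsLemma x y pp p∣xy)

-- Counting multiples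

applyUpTo-+ : (f : ℕ → A) → ∀ m n → applyUpTo f (m + n) ≡ applyUpTo f m ++ applyUpTo (f ∘ (_+_ m)) n
applyUpTo-+ f zero    n = refl
applyUpTo-+ f (suc m) n = cong (f 0 ∷_) (applyUpTo-+ (f ∘ suc) m n)

tabulate-∘toℕ : (f : ℕ → A) → ∀ n → tabulate {n = n} (f ∘ toℕ) ≡ applyUpTo f n
tabulate-∘toℕ f zero    = refl
tabulate-∘toℕ f (suc n) = cong (f 0 ∷_) (tabulate-∘toℕ (f ∘ suc) n)

count-allFin : {P : Pred ℕ ℓ} (P? : Decidable P) → ∀ n → count (P? ∘ toℕ) (allFin n) ≡ count P? (upTo n)
count-allFin P? n = begin
  count (P? ∘ toℕ) (allFin n)   ≡⟨ count-map P? toℕ (allFin n) ⟨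
  count P? (map toℕ (allFin n)) ≡⟨ cong (count P?) (trans (map-tabulate id toℕ) (tabulate-∘toℕ id n)) ⟩
  count P? (upTo n)             ∎
  where open ≡-Reasoning

-- The single multiple is 0, so 0 is included in all counts of multiples below.
count-∣-period : ∀ d .{{_ : NonZero d}} → count (d ∣?_) (upTo d) ≡ 1
count-∣-period d@(suc d′) = trans
  (cong length (filter-accept (d ∣?_) {xs = applyUpTo suc d′} (d ∣0)))
  (cong (suc ∘ length) (filter-none (d ∣?_) (All.applyUpTo⁺₁ suc d′ (λ i<d′ → >⇒∤ (s≤s i<d′)))))

count-∣ : ∀ d .{{_ : NonZero d}} m → count (d ∣?_) (upTo (m * d)) ≡ m
count-∣ d zero    = refl
count-∣ d (suc m) = begin
  count d∣? (upTo (d + m * d))                                 ≡⟨ cong (count d∣?) (applyUpTo-+ id d (m * d)) ⟩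
  count d∣? (upTo d ++ applyUpTo (_+_ d) (m * d))              ≡⟨ count-++ d∣? (upTo d) _ ⟩
  count d∣? (upTo d) + count d∣? (applyUpTo (_+_ d) (m * d))   ≡⟨ cong₂ _+_ (count-∣-period d) shift ⟩
  suc m                                                        ∎
  where
  open ≡-Reasoning
  d∣? = d ∣?_
  shift : count d∣? (applyUpTo (_+_ d) (m * d)) ≡ m
  shift = begin
    count d∣? (applyUpTo (_+_ d) (m * d))        ≡⟨ cong (count d∣?) (map-upTo (_+_ d) (m * d)) ⟨
    count d∣? (map (_+_ d) (upTo (m * d)))       ≡⟨ count-map d∣? (_+_ d) (upTo (m * d)) ⟩
    count (d∣? ∘ (_+_ d)) (upTo (m * d))
      ≡⟨ count-cong _ d∣? ((λ d∣d+x → ∣m+n∣m⇒∣n d∣d+x ∣-refl) , ∣m∣n⇒∣m+n ∣-refl) (upTo (m * d)) ⟩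
    count d∣? (upTo (m * d))                     ≡⟨ count-∣ d m ⟩
    m                                            ∎

-- There are m·e multiples of `d` below n, and by coprimality those also divisible by `e` are the m
-- multiples of d·e.
count-∣-∤ : ∀ d e .{{_ : NonZero d}} .{{_ : NonZero e}} → Coprime d e → ∀ m → n ≡ m * (d * e) →
  count ((d ∣?_) ∩? ∁? (e ∣?_)) (upTo n) + m ≡ m * e
count-∣-∤ {n} d e de m n≡ = begin
  count (d∣? ∩? ∁? e∣?) (upTo n) + m
    ≡⟨ cong (_+_ (count (d∣? ∩? ∁? e∣?) (upTo n))) both ⟨
  count (d∣? ∩? ∁? e∣?) (upTo n) + count (d∣? ∩? e∣?) (upTo n)
    ≡⟨ +-comm (count (d∣? ∩? ∁? e∣?) (upTo n)) _ ⟩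
  count (d∣? ∩? e∣?) (upTo n) + count (d∣? ∩? ∁? e∣?) (upTo n)
    ≡⟨ count-∩-∁ d∣? e∣? (upTo n) ⟨
  count d∣? (upTo n)
    ≡⟨ cong (λ n → count d∣? (upTo n)) (trans n≡ (trans (cong (m *_) (*-comm d e)) (sym (*-assoc m e d)))) ⟩
  count d∣? (upTo (m * e * d))
    ≡⟨ count-∣ d (m * e) ⟩
  m * e ∎
  where
  open ≡-Reasoning
  instance _ = m*n≢0 d e
  d∣? = d ∣?_
  e∣? = e ∣?_
  both : count (d∣? ∩? e∣?) (upTo n) ≡ m
  both = begin
    count (d∣? ∩? e∣?) (upTo n)
      ≡⟨ count-cong (d∣? ∩? e∣?) (d * e ∣?_)
           ((λ (d∣x , e∣x) → coprime-*-∣ de d∣x e∣x) , (λ de∣x → m*n∣⇒m∣ d e de∣x , m*n∣⇒n∣ d e de∣x)) (upTo n) ⟩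
    count (d * e ∣?_) (upTo n)              ≡⟨ cong (λ n → count (d * e ∣?_) (upTo n)) n≡ ⟩
    count (d * e ∣?_) (upTo (m * (d * e)))  ≡⟨ count-∣ (d * e) m ⟩
    m                                       ∎

-- Products of residues

·-zero⇒∣ : (a b : Fin n) → IsZero (a · b) → n ∣ toℕ a * toℕ b
·-zero⇒∣ {suc n} a b ab≡0 = m%n≡0⇒n∣m _ (suc n) (trans (sym (toℕ-fromℕ< (m%n<n (toℕ a * toℕ b) (suc n)))) ab≡0)

∣⇒·-zero : (a b : Fin n) → n ∣ toℕ a * toℕ b → IsZero (a · b)
∣⇒·-zero {suc n} a b n∣ab = trans (toℕ-fromℕ< (m%n<n (toℕ a * toℕ b) (suc n))) (n∣m⇒m%n≡0 _ (suc n) n∣ab)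

∣toℕ⇒zero : (a : Fin n) → n ∣ toℕ a → IsZero a
∣toℕ⇒zero {n} a n∣a with toℕ a | toℕ<n a
... | zero  | _   = refl
... | suc _ | a<n = contradiction n∣a (>⇒∤ a<n)

∤toℕ⇒nonzero : (a : Fin n) → n ∤ toℕ a → ¬ IsZero a
∤toℕ⇒nonzero {n} a n∤a a≡0 = n∤a (subst (n ∣_) (sym a≡0) (n ∣0))

-- The annihilator is the cofactor `e`: it is a residue because 1 < d makes it smaller than n, and
-- it is not zero.
divisor⇒zeroDivisor : ∀ d e .{{_ : NonZero e}} → 1 < d → n ≡ d * e →
  (a : Fin n) → d ∣ toℕ a → ¬ IsZero a → NonZeroZeroDivisor a
divisor⇒zeroDivisor {n} d e 1<d n≡de a d∣a a≢0 = a≢0 , b , b≢0 , ∣⇒·-zero a b n∣ab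
  where
  e<n : e < n
  e<n = subst (e <_) (trans (*-comm e d) (sym n≡de)) (m<m*n e d 1<d)
  b = fromℕ< e<n
  b≢0 : ¬ IsZero b
  b≢0 b≡0 = m<n⇒n≢0 (m<m*n e d 1<d) (cong (_* d) (trans (sym (toℕ-fromℕ< e<n)) b≡0))
  n∣ab : n ∣ toℕ a * toℕ b
  n∣ab = subst₂ (λ x y → x ∣ toℕ a * y) (sym n≡de) (sym (toℕ-fromℕ< e<n)) (*-monoˡ-∣ e d∣a)

-- The zero divisor graph of ℤ/p²q

module _ {p q : ℕ} (p-prime : Prime p) (q-prime : Prime q) (p<q : p < q) where

  private
    instance
      p≢0 = prime⇒nonZero p-prime
      q≢0 = prime⇒nonZero q-prime
      p²≢0 = m^n≢0 p 2

    N = p ^ 2 * q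

    1<p : 1 < p
    1<p = nonTrivial⇒n>1 p {{prime⇒nonTrivial p-prime}}

    1<q : 1 < q
    1<q = <-trans 1<p p<q

    coprime-p-q : Coprime p q
    coprime-p-q = coprime-sym (prime⇒coprime q-prime p<q)

    p²≡p*p : p ^ 2 ≡ p * p
    p²≡p*p = cong (p *_) (*-identityʳ p)

    N≡p*pq : N ≡ p * (p * q)
    N≡p*pq = trans (cong (_* q) p²≡p*p) (*-assoc p p q)

    N≡q*p² : N ≡ q * p ^ 2
    N≡q*p² = *-comm (p ^ 2) q

    p∣p² : p ∣ p ^ 2
    p∣p² = m∣m*n (p * 1)

    p∣N : p ∣ N
    p∣N = ∣m⇒∣m*n q p∣p²

    q∣N : q ∣ N
    q∣N = n∣m*n (p ^ 2)

    -- V[d,e] stands for the x with gcd x N ∈ {d , e}, and V[d] for those with gcd x N ≡ d.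
    V[p,p²] V[p²] V[p] V[q] V[pq] V[p,q] : Pred ℕ 0ℓ
    V[p,p²] = (p ∣_) ∩ ∁ (q ∣_)
    V[p²]   = (p ^ 2 ∣_) ∩ ∁ (q ∣_)
    V[p]    = V[p,p²] ∩ ∁ (p ^ 2 ∣_)
    V[q]    = (q ∣_) ∩ ∁ (p ∣_)
    V[pq]   = (p * q ∣_) ∩ ∁ (N ∣_)
    V[p,q]  = V[p] ∪ V[q]

    v[p,p²]? : Decidable V[p,p²]
    v[p,p²]? = (p ∣?_) ∩? ∁? (q ∣?_)

    v[p²]? : Decidable V[p²]
    v[p²]? = (p ^ 2 ∣?_) ∩? ∁? (q ∣?_)

    v[p]? : Decidable V[p]
    v[p]? = v[p,p²]? ∩? ∁? (p ^ 2 ∣?_)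

    v[q]? : Decidable V[q]
    v[q]? = (q ∣?_) ∩? ∁? (p ∣?_)

    v[pq]? : Decidable V[pq]
    v[pq]? = (p * q ∣?_) ∩? ∁? (N ∣?_)

    v[p,q]? : Decidable V[p,q]
    v[p,q]? = v[p]? ∪? v[q]?

    -- Sizes of the divisibility classes

    m+n≡o⇒m≡o∸n : ∀ {m n o} → m + n ≡ o → m ≡ o ∸ n
    m+n≡o⇒m≡o∸n {m} {n} refl = sym (m+n∸n≡m m n)

    m*n∸m≡m*[n∸1] : ∀ m n → m * n ∸ m ≡ m * (n ∸ 1)
    m*n∸m≡m*[n∸1] m n = trans (cong (m * n ∸_) (sym (*-identityʳ m))) (sym (*-distribˡ-∸ m n 1))

    #V[p,p²] : count v[p,p²]? (upTo N) ≡ p * (q ∸ 1)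
    #V[p,p²] = trans (m+n≡o⇒m≡o∸n (count-∣-∤ p q coprime-p-q p N≡p*pq)) (m*n∸m≡m*[n∸1] p q)

    #V[p²] : count v[p²]? (upTo N) ≡ q ∸ 1
    #V[p²] = trans
      (m+n≡o⇒m≡o∸n (count-∣-∤ (p ^ 2) q (coprime-^ 2 coprime-p-q) 1 (sym (*-identityˡ N))))
      (cong (_∸ 1) (*-identityˡ q))

    #V[q] : count v[q]? (upTo N) ≡ p * (p ∸ 1)
    #V[q] = trans
      (m+n≡o⇒m≡o∸n (count-∣-∤ q p (coprime-sym coprime-p-q) p (trans N≡p*pq (cong (p *_) (*-comm p q)))))
      (m*n∸m≡m*[n∸1] p p)

    pq∣N : p * q ∣ N
    pq∣N = subst (p * q ∣_) (sym N≡p*pq) (n∣m*n p)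

    -- Of the p multiples of pq below N only 0 is a multiple of N; it accounts for the 1 taken away.
    #V[pq] : count v[pq]? (upTo N) ≡ p ∸ 1
    #V[pq] = m+n≡o⇒m≡o∸n (begin
      count v[pq]? (upTo N) + 1                                            ≡⟨ cong (_+_ (count v[pq]? (upTo N))) multiples-of-N ⟨
      count v[pq]? (upTo N) + count ((p * q ∣?_) ∩? (N ∣?_)) (upTo N)      ≡⟨ +-comm (count v[pq]? (upTo N)) _ ⟩
      count ((p * q ∣?_) ∩? (N ∣?_)) (upTo N) + count v[pq]? (upTo N)      ≡⟨ count-∩-∁ (p * q ∣?_) (N ∣?_) (upTo N) ⟨
      count (p * q ∣?_) (upTo N)                                           ≡⟨ cong (λ n → count (p * q ∣?_) (upTo n)) N≡p*pq ⟩
      count (p * q ∣?_) (upTo (p * (p * q)))                               ≡⟨ count-∣ (p * q) {{m*n≢0 p q}} p ⟩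
      p                                                                    ∎)
      where
      open ≡-Reasoning
      multiples-of-N : count ((p * q ∣?_) ∩? (N ∣?_)) (upTo N) ≡ 1
      multiples-of-N = trans
        (count-cong ((p * q ∣?_) ∩? (N ∣?_)) (N ∣?_) (proj₂ , λ N∣x → ∣-trans pq∣N N∣x , N∣x) (upTo N))
        (count-∣-period N {{m*n≢0 (p ^ 2) q}})

    -- Removing `V[p²]` from `V[p,p²]` leaves p(q-1) - (q-1).
    #V[p] : count v[p]? (upTo N) ≡ (p ∸ 1) * (q ∸ 1)
    #V[p] = trans (m+n≡o⇒m≡o∸n (begin
      count v[p]? (upTo N) + (q ∸ 1)                                             ≡⟨ cong (_+_ (count v[p]? (upTo N))) #V[p²] ⟨
      count v[p]? (upTo N) + count v[p²]? (upTo N)                               ≡⟨ +-comm (count v[p]? (upTo N)) _ ⟩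
      count v[p²]? (upTo N) + count v[p]? (upTo N)                               ≡⟨ cong (_+ count v[p]? (upTo N)) split ⟩
      count (v[p,p²]? ∩? (p ^ 2 ∣?_)) (upTo N) + count v[p]? (upTo N)            ≡⟨ count-∩-∁ v[p,p²]? (p ^ 2 ∣?_) (upTo N) ⟨
      count v[p,p²]? (upTo N)                                                    ≡⟨ #V[p,p²] ⟩
      p * (q ∸ 1)                                                                ∎))
      (trans (cong (p * (q ∸ 1) ∸_) (sym (*-identityˡ (q ∸ 1)))) (sym (*-distribʳ-∸ (q ∸ 1) p 1)))
      where
      open ≡-Reasoning
      split : count v[p²]? (upTo N) ≡ count (v[p,p²]? ∩? (p ^ 2 ∣?_)) (upTo N)
      split = count-cong v[p²]? (v[p,p²]? ∩? (p ^ 2 ∣?_))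
        ( (λ (p²∣x , q∤x) → (∣-trans p∣p² p²∣x , q∤x) , p²∣x)
        , (λ ((_ , q∤x) , p²∣x) → p²∣x , q∤x)) (upTo N)

    #V[p,q] : count v[p,q]? (upTo N) ≡ (p ∸ 1) * (p + q ∸ 1)
    #V[p,q] = begin
      count v[p,q]? (upTo N)                       ≡⟨ count-disjoint-∪ v[p]? v[q]? (λ x ((p∣x , _) , _) (_ , p∤x) → p∤x p∣x) (upTo N) ⟩
      count v[p]? (upTo N) + count v[q]? (upTo N)  ≡⟨ cong₂ _+_ #V[p] #V[q] ⟩
      (p ∸ 1) * (q ∸ 1) + p * (p ∸ 1)              ≡⟨ cong (_+_ ((p ∸ 1) * (q ∸ 1))) (*-comm p (p ∸ 1)) ⟩
      (p ∸ 1) * (q ∸ 1) + (p ∸ 1) * p              ≡⟨ *-distribˡ-+ (p ∸ 1) (q ∸ 1) p ⟨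
      (p ∸ 1) * (q ∸ 1 + p)                        ≡⟨ cong ((p ∸ 1) *_) (+-comm (q ∸ 1) p) ⟩
      -- With truncated subtraction this regrouping needs 1 ≤ q.
      (p ∸ 1) * (p + (q ∸ 1))                      ≡⟨ cong ((p ∸ 1) *_) (+-∸-assoc p (<⇒≤ 1<q)) ⟨
      (p ∸ 1) * (p + q ∸ 1)                        ∎
      where open ≡-Reasoning

    -- Vertices in terms of divisibility

    -- If neither prime divided `a`, then `a` would be coprime to N, and N would divide every
    -- annihilator of `a`, forcing it to be 0.
    vertex⇒∣ : (a : Fin N) → NonZeroZeroDivisor a → p ∣ toℕ a ⊎ q ∣ toℕ a
    vertex⇒∣ a (_ , b , b≢0 , ab≡0) with p ∣? toℕ a | q ∣? toℕ a
    ... | yes p∣a | _       = inj₁ p∣a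
    ... | no  _   | yes q∣a = inj₂ q∣a
    ... | no  p∤a | no  q∤a = contradiction (∣toℕ⇒zero b (coprime-divisor coprime-N-a (·-zero⇒∣ a b ab≡0))) b≢0
      where
      coprime-N-a : Coprime N (toℕ a)
      coprime-N-a = coprime-* (coprime-^ 2 (prime∤⇒coprime p-prime p∤a)) (prime∤⇒coprime q-prime q∤a)

    ∣⇒vertex : (a : Fin N) → p ∣ toℕ a ⊎ q ∣ toℕ a → N ∤ toℕ a → NonZeroZeroDivisor a
    ∣⇒vertex a (inj₁ p∣a) N∤a = divisor⇒zeroDivisor p (p * q) {{m*n≢0 p q}} 1<p N≡p*pq a p∣a (∤toℕ⇒nonzero a N∤a)
    ∣⇒vertex a (inj₂ q∣a) N∤a = divisor⇒zeroDivisor q (p ^ 2) 1<q N≡q*p² a q∣a (∤toℕ⇒nonzero a N∤a)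

    p²∣*⇒p²∣ : ∀ {x y} → p ∤ y → p ^ 2 ∣ x * y → p ^ 2 ∣ x
    p²∣*⇒p²∣ {x} {y} p∤y p²∣xy =
      coprime-divisor (coprime-^ 2 (prime∤⇒coprime p-prime p∤y)) (subst (p ^ 2 ∣_) (*-comm x y) p²∣xy)

    p²q∣ : ∀ {x} → p ^ 2 ∣ x → q ∣ x → N ∣ x
    p²q∣ = coprime-*-∣ (coprime-^ 2 coprime-p-q)

    pq∣ : ∀ {x} → p ∣ x → q ∣ x → p * q ∣ x
    pq∣ = coprime-*-∣ coprime-p-q

    p²∣N : p ^ 2 ∣ N
    p²∣N = m∣m*n q

    -- Classification of the independent sets

    Indep : Pred (Subset N) 0ℓ
    Indep = Independent (Γ N)

    L[p,q] L[p,p²] One : Pred (Subset N) 0ℓ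
    L[p,q]  = Lift (V[p,q] ∘ toℕ)
    L[p,p²] = Lift (V[p,p²] ∘ toℕ)
    One     = OneIn (V[pq] ∘ toℕ) (V[q] ∘ toℕ)

    nonadjacent : (a b : Fin N) → N ∤ toℕ a * toℕ b → ¬ Graph.Adj (Γ N) a b
    nonadjacent a b N∤ab (_ , _ , ab≡0) = N∤ab (·-zero⇒∣ a b ab≡0)

    adjacent : (a b : Fin N) → NonZeroZeroDivisor a → NonZeroZeroDivisor b → a ≢ b → N ∣ toℕ a * toℕ b →
      Graph.Adj (Γ N) a b
    adjacent a b va vb a≢b N∣ab = (va , vb) , a≢b , ∣⇒·-zero a b N∣ab

    V[q]-∤-* : ∀ {x y} → V[q] x → V[q] y → N ∤ x * y
    V[q]-∤-* (_ , p∤x) (_ , p∤y) N∣xy = prime-∤-* p-prime p∤x p∤y (∣-trans p∣N N∣xy)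

    V[p,p²]-∤-* : ∀ {x y} → V[p,p²] x → V[p,p²] y → N ∤ x * y
    V[p,p²]-∤-* (_ , q∤x) (_ , q∤y) N∣xy = prime-∤-* q-prime q∤x q∤y (∣-trans q∣N N∣xy)

    -- The product contains p only once: one factor from x, none from y.
    V[p]-V[q]-∤-* : ∀ {x y} → V[p] x → V[q] y → N ∤ x * y
    V[p]-V[q]-∤-* (_ , p²∤x) (_ , p∤y) N∣xy = p²∤x (p²∣*⇒p²∣ p∤y (∣-trans p²∣N N∣xy))

    -- As y contributes no factor p, x would have to supply p² besides its q, and so be a multiple
    -- of N.
    V[pq]-V[q]-∤-* : ∀ {x y} → V[pq] x → V[q] y → N ∤ x * y
    V[pq]-V[q]-∤-* (pq∣x , N∤x) (_ , p∤y) N∣xy =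
      N∤x (p²q∣ (p²∣*⇒p²∣ p∤y (∣-trans p²∣N N∣xy)) (m*n∣⇒n∣ p q pq∣x))

    V[p,q]-∤-* : ∀ {x y} → V[p,q] x → V[p,q] y → N ∤ x * y
    V[p,q]-∤-* (inj₁ (x∈ , _)) (inj₁ (y∈ , _)) = V[p,p²]-∤-* x∈ y∈
    V[p,q]-∤-* (inj₁ x∈) (inj₂ y∈) = V[p]-V[q]-∤-* x∈ y∈
    V[p,q]-∤-* {x} {y} (inj₂ x∈) (inj₁ y∈) = V[p]-V[q]-∤-* y∈ x∈ ∘ subst (N ∣_) (*-comm x y)
    V[p,q]-∤-* (inj₂ x∈) (inj₂ y∈) = V[q]-∤-* x∈ y∈

    vertex-V[p,p²] : (a : Fin N) → V[p,p²] (toℕ a) → NonZeroZeroDivisor a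
    vertex-V[p,p²] a (p∣a , q∤a) = ∣⇒vertex a (inj₁ p∣a) (q∤a ∘ ∣-trans q∣N)

    vertex-V[q] : (a : Fin N) → V[q] (toℕ a) → NonZeroZeroDivisor a
    vertex-V[q] a (q∣a , p∤a) = ∣⇒vertex a (inj₂ q∣a) (p∤a ∘ ∣-trans p∣N)

    vertex-V[p,q] : (a : Fin N) → V[p,q] (toℕ a) → NonZeroZeroDivisor a
    vertex-V[p,q] a (inj₁ (a∈ , _)) = vertex-V[p,p²] a a∈
    vertex-V[p,q] a (inj₂ a∈)       = vertex-V[q] a a∈

    L[p,q]⊆Indep : L[p,q] ⊆ Indep
    L[p,q]⊆Indep l = (λ {a} a∈S → vertex-V[p,q] a (l a∈S)) ,
      λ {a} a∈S {b} b∈S → nonadjacent a b (V[p,q]-∤-* (l a∈S) (l b∈S))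

    L[p,p²]⊆Indep : L[p,p²] ⊆ Indep
    L[p,p²]⊆Indep l = (λ {a} a∈S → vertex-V[p,p²] a (l a∈S)) ,
      λ {a} a∈S {b} b∈S → nonadjacent a b (V[p,p²]-∤-* (l a∈S) (l b∈S))

    One⊆Indep : One ⊆ Indep
    One⊆Indep {S} (c , c∈S , c∈@(pq∣c , N∤c) , l) = vertices , nonadj
      where
      vertices : Lift NonZeroZeroDivisor S
      vertices {a} a∈S with l a∈S
      ... | inj₁ refl = ∣⇒vertex a (inj₁ (m*n∣⇒m∣ p q pq∣c)) N∤c
      ... | inj₂ a∈   = vertex-V[q] a a∈
      nonadj : Lift (λ a → Lift (λ b → ¬ Graph.Adj (Γ N) a b) S) S
      nonadj {a} a∈S {b} b∈S with l a∈S | l b∈S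
      -- N does divide the square of `c`, so only the absence of loops settles this case.
      ... | inj₁ refl | inj₁ refl = Graph.adj-irrefl (Γ N)
      ... | inj₁ refl | inj₂ b∈   = nonadjacent a b (V[pq]-V[q]-∤-* c∈ b∈)
      ... | inj₂ a∈   | inj₁ refl = nonadjacent b a (V[pq]-V[q]-∤-* c∈ a∈) ∘ Graph.adj-sym (Γ N)
      ... | inj₂ a∈   | inj₂ b∈   = nonadjacent a b (V[q]-∤-* a∈ b∈)

    Indep⊆ : Indep ⊆ (L[p,q] ∪ L[p,p²]) ∪ One
    Indep⊆ {S} (vertices , nonadj) = split
      where
      N∤ : ∀ {a b} → a ∈ S → b ∈ S → a ≢ b → N ∤ toℕ a * toℕ b
      N∤ {a} {b} a∈S b∈S a≢b N∣ab = nonadj a∈S b∈S (adjacent a b (vertices a∈S) (vertices b∈S) a≢b N∣ab)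

      N∤toℕ : ∀ {a} → a ∈ S → N ∤ toℕ a
      N∤toℕ {a} a∈S = proj₁ (vertices a∈S) ∘ ∣toℕ⇒zero a

      one : ∀ {c} → c ∈ S → p * q ∣ toℕ c → One S
      one {c} c∈S pq∣c = c , c∈S , (pq∣c , N∤toℕ c∈S) , others
        where
        others : Lift (λ x → x ≡ c ⊎ V[q] (toℕ x)) S
        others {x} x∈S with x ≟ᶠ c
        ... | yes x≡c = inj₁ x≡c
        ... | no  x≢c with p ∣? toℕ x
        -- p divides x and pq divides c, so p·pq = N divides their product and x would be adjacent
        -- to c.
        ...   | yes p∣x = contradiction (subst (_∣ toℕ x * toℕ c) (sym N≡p*pq) (*-pres-∣ p∣x pq∣c)) (N∤ x∈S c∈S x≢c)
        ...   | no  p∤x with vertex⇒∣ x (vertices x∈S)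
        ...     | inj₁ p∣x = contradiction p∣x p∤x
        ...     | inj₂ q∣x = inj₂ (q∣x , p∤x)

      -- The presence of a multiple of q in `S` decides the alternative, since such an element
      -- excludes all of `V[p²]`. Subsets of `V[p]` contain none and are sent to `L[p,p²]`.
      none-in-V[pq] : (∀ {x} → x ∈ S → p * q ∤ toℕ x) → (L[p,q] ∪ L[p,p²]) S
      none-in-V[pq] pq∤ with any? (λ c → c ∈? S ×-dec q ∣? toℕ c)
      ... | yes (c , c∈S , q∣c) = inj₁ V[p,q]-all
        where
        V[p,q]-all : L[p,q] S
        V[p,q]-all {x} x∈S with q ∣? toℕ x
        ... | yes q∣x = inj₂ (q∣x , λ p∣x → pq∤ x∈S (pq∣ p∣x q∣x))
        ... | no  q∤x with vertex⇒∣ x (vertices x∈S)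
        ...   | inj₂ q∣x = contradiction q∣x q∤x
        -- If p² divided x, then N = p²·q would divide the product of x and c; the two differ
        -- because q divides only c.
        ...   | inj₁ p∣x = inj₁ ((p∣x , q∤x) , λ p²∣x →
                  N∤ x∈S c∈S (λ { refl → q∤x q∣c }) (*-pres-∣ p²∣x q∣c))
      ... | no ∄c = inj₂ V[p,p²]-all
        where
        V[p,p²]-all : L[p,p²] S
        V[p,p²]-all {x} x∈S with vertex⇒∣ x (vertices x∈S)
        ... | inj₁ p∣x = p∣x , λ q∣x → ∄c (x , x∈S , q∣x)
        ... | inj₂ q∣x = contradiction (x , x∈S , q∣x) ∄c

      split : ((L[p,q] ∪ L[p,p²]) ∪ One) S
      split with any? (λ c → c ∈? S ×-dec p * q ∣? toℕ c)
      ... | yes (c , c∈S , pq∣c) = inj₂ (one c∈S pq∣c)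
      ... | no  ∄c               = inj₁ (none-in-V[pq] (λ {x} x∈S pq∣x → ∄c (x , x∈S , pq∣x)))

    Indep≐ : Indep ≐ (L[p,q] ∪ L[p,p²]) ∪ One
    Indep≐ = Indep⊆ , [ [ L[p,q]⊆Indep , L[p,p²]⊆Indep ]′ , One⊆Indep ]′

    -- Identifies the sets counted twice, whose number is the coefficient subtracted in the theorem.
    L∩L≐ : L[p,q] ∩ L[p,p²] ≐ Lift (V[p] ∘ toℕ)
    L∩L≐ = (λ (l , l′) {x} x∈S → meet (toℕ x) (l x∈S) (l′ x∈S)) , λ l → (λ x∈S → inj₁ (l x∈S)) , (λ x∈S → proj₁ (l x∈S))
      where
      meet : ∀ x → V[p,q] x → V[p,p²] x → V[p] x
      meet _ (inj₁ x∈) _ = x∈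
      meet _ (inj₂ (q∣x , _)) (_ , q∤x) = contradiction q∣x q∤x

    L-One-disjoint : ∀ S → (L[p,q] ∪ L[p,p²]) S → ¬ One S
    L-One-disjoint S (inj₁ l) (c , c∈S , (pq∣c , _) , _) with l c∈S
    ... | inj₁ ((_ , q∤c) , _) = q∤c (m*n∣⇒n∣ p q pq∣c)
    ... | inj₂ (_ , p∤c)       = p∤c (m*n∣⇒m∣ p q pq∣c)
    L-One-disjoint S (inj₂ l) (c , c∈S , (pq∣c , _) , _) = proj₂ (l c∈S) (m*n∣⇒n∣ p q pq∣c)

    -- Counting the independent sets

    l[p,q]? : Decidable L[p,q]
    l[p,q]? = Lift? (v[p,q]? ∘ toℕ)

    l[p,p²]? : Decidable L[p,p²]
    l[p,p²]? = Lift? (v[p,p²]? ∘ toℕ)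

    one? : Decidable One
    one? = oneIn? (v[pq]? ∘ toℕ) (v[q]? ∘ toℕ)

    -- The classes are predicates on ℕ, so their sizes are computed on `upTo N` and carried to the
    -- residues along `toℕ`.
    countSets-Lift-toℕ : {V : Pred ℕ 0ℓ} (V? : Decidable V) → ∀ {m} → count V? (upTo N) ≡ m →
      ∀ k → countSets {n = N} (Lift? (V? ∘ toℕ)) k ≡ m C k
    countSets-Lift-toℕ V? #V k = trans (countSets-Lift {n = N} (V? ∘ toℕ) k) (cong (_C k) (trans (count-allFin V? N) #V))

  -- The overlap is added on the left rather than subtracted on the right. The `One` sets stay
  -- uncounted because their number has different forms at 0 and at successors.
  s-Γ[p²q] : ∀ k → s (Γ N) k + ((p ∸ 1) * (q ∸ 1)) C k ≡
    ((p ∸ 1) * (p + q ∸ 1)) C k + (p * (q ∸ 1)) C k + countSets one? k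
  s-Γ[p²q] k = begin
    s (Γ N) k + ((p ∸ 1) * (q ∸ 1)) C k
      ≡⟨ cong₂ _+_ s≡ (sym both) ⟩
    countSets (l[p,q]? ∪? l[p,p²]?) k + countSets one? k + countSets (l[p,q]? ∩? l[p,p²]?) k
      ≡⟨ +-assoc x y z ⟩
    x + (y + z)
      ≡⟨ cong (_+_ x) (+-comm y z) ⟩
    x + (z + y)
      ≡⟨ +-assoc x z y ⟨
    x + z + y
      ≡⟨ cong (_+ y) (countSets-∪-∩ l[p,q]? l[p,p²]? k) ⟩
    countSets l[p,q]? k + countSets l[p,p²]? k + y
      ≡⟨ cong₂ (λ u v → u + v + y) (countSets-Lift-toℕ v[p,q]? #V[p,q] k) (countSets-Lift-toℕ v[p,p²]? #V[p,p²] k) ⟩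
    ((p ∸ 1) * (p + q ∸ 1)) C k + (p * (q ∸ 1)) C k + y ∎
    where
    open ≡-Reasoning
    x = countSets (l[p,q]? ∪? l[p,p²]?) k
    y = countSets one? k
    z = countSets (l[p,q]? ∩? l[p,p²]?) k
    s≡ : s (Γ N) k ≡ x + y
    s≡ = trans (s≡countSets (Γ N) k) (trans
      (countSets-cong (independent? (Γ N)) ((l[p,q]? ∪? l[p,p²]?) ∪? one?) Indep≐ k)
      (countSets-disjoint-∪ (l[p,q]? ∪? l[p,p²]?) one? L-One-disjoint k))
    both : z ≡ ((p ∸ 1) * (q ∸ 1)) C k
    both = trans
      (countSets-cong (l[p,q]? ∩? l[p,p²]?) (Lift? (v[p]? ∘ toℕ)) L∩L≐ k)
      (countSets-Lift-toℕ v[p]? #V[p] k)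

  -- The factor `X` shifts the index by one, matching the centre, which takes up one of the `suc k`
  -- elements.
  coeff-One : ∀ k → coeff (const (+ (p ∸ 1)) ⊗ X ⊗ (const 1ℤ ⊕ X) ^ᴾ (p * (p ∸ 1))) k ≡ + countSets one? k
  coeff-One zero = trans (coeff-cX⊗-zero (+ (p ∸ 1)) ((const 1ℤ ⊕ X) ^ᴾ (p * (p ∸ 1))))
    (cong +_ (sym (countSets-OneIn-zero {n = N} (v[pq]? ∘ toℕ) (v[q]? ∘ toℕ))))
  coeff-One (suc k) = begin
    coeff (const (+ (p ∸ 1)) ⊗ X ⊗ Y) (suc k)
      ≡⟨ coeff-cX⊗-suc (+ (p ∸ 1)) Y k ⟩
    + (p ∸ 1) ℤ.* coeff Y k
      ≡⟨ cong (+ (p ∸ 1) ℤ.*_) (coeff-[1+X]^ (p * (p ∸ 1)) k) ⟩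
    + (p ∸ 1) ℤ.* + ((p * (p ∸ 1)) C k)
      ≡⟨ ℤ.pos-* (p ∸ 1) ((p * (p ∸ 1)) C k) ⟨
    + ((p ∸ 1) * ((p * (p ∸ 1)) C k))
      ≡⟨ cong₂ (λ r m → + (r * (m C k)))
           (trans (count-allFin v[pq]? N) #V[pq]) (trans (count-allFin v[q]? N) #V[q]) ⟨
    + (count (v[pq]? ∘ toℕ) (allFin N) * (count (v[q]? ∘ toℕ) (allFin N) C k))
      ≡⟨ cong +_ (countSets-OneIn-suc {n = N} (v[pq]? ∘ toℕ) (v[q]? ∘ toℕ)
           (λ x (pq∣x , _) (_ , p∤x) → p∤x (m*n∣⇒m∣ p q pq∣x)) k) ⟨
    + countSets one? (suc k) ∎
    where
    open ≡-Reasoning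
    Y = (const 1ℤ ⊕ X) ^ᴾ (p * (p ∸ 1))

-- Passage to integer coefficients

-- The right side is ordered and bracketed like the four summands of the theorem, so it can be
-- rewritten coefficient by coefficient.
pos-inclusion-exclusion : ∀ {s a b c d} → s + c ≡ a + b + d → + s ≡ + a ℤ.+ + b ℤ.- + c ℤ.+ + d
pos-inclusion-exclusion {s} {a} {b} {c} {d} e = begin
  + s                                       ≡⟨ ℤ.+-identityʳ (+ s) ⟨
  + s ℤ.+ 0ℤ                                ≡⟨ cong (ℤ._+_ (+ s)) (ℤ.+-inverseʳ (+ c)) ⟨
  + s ℤ.+ (+ c ℤ.- + c)                     ≡⟨ ℤ.+-assoc (+ s) (+ c) (ℤ.- + c) ⟨
  + (s + c) ℤ.- + c                         ≡⟨ cong (λ x → + x ℤ.- + c) e ⟩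
  (+ (a + b) ℤ.+ + d) ℤ.- + c               ≡⟨ ℤ.+-assoc (+ (a + b)) (+ d) (ℤ.- + c) ⟩
  + (a + b) ℤ.+ (+ d ℤ.- + c)               ≡⟨ cong (ℤ._+_ (+ (a + b))) (ℤ.+-comm (+ d) (ℤ.- + c)) ⟩
  + (a + b) ℤ.+ (ℤ.- + c ℤ.+ + d)           ≡⟨ ℤ.+-assoc (+ (a + b)) (ℤ.- + c) (+ d) ⟨
  + (a + b) ℤ.- + c ℤ.+ + d                 ∎
  where open ≡-Reasoning

theorem3p1 : (p q : ℕ) → Prime p → Prime q → p < q →
    independencePoly (Γ (p ^ 2 * q)) ≈
    (const 1ℤ ⊕ X) ^ᴾ ((p ∸ 1) * (p + q ∸ 1))
    ⊕ (const 1ℤ ⊕ X) ^ᴾ (p * (q ∸ 1))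
    ⊖ (const 1ℤ ⊕ X) ^ᴾ ((p ∸ 1) * (q ∸ 1))
    ⊕ const (+ (p ∸ 1)) ⊗ X ⊗ (const 1ℤ ⊕ X) ^ᴾ (p * (p ∸ 1))
theorem3p1 p q p-prime q-prime p<q k = begin
  coeff (independencePoly (Γ (p ^ 2 * q))) k
    ≡⟨ coeff-independencePoly (Γ (p ^ 2 * q)) k ⟩
  + s (Γ (p ^ 2 * q)) k
    ≡⟨ pos-inclusion-exclusion {a = a C k} {b = b C k} (s-Γ[p²q] p-prime q-prime p<q k) ⟩
  _
    ≡⟨ cong₂ ℤ._+_
         (cong₂ ℤ._-_ (cong₂ ℤ._+_ (coeff-[1+X]^ a k) (coeff-[1+X]^ b k)) (coeff-[1+X]^ c k))
         (coeff-One p-prime q-prime p<q k) ⟨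
  coeff f k ℤ.+ coeff g k ℤ.- coeff h k ℤ.+ coeff l k
    ≡⟨ cong (λ x → x ℤ.- coeff h k ℤ.+ coeff l k) (coeff-⊕ f g k) ⟨
  coeff (f ⊕ g) k ℤ.- coeff h k ℤ.+ coeff l k
    ≡⟨ cong (ℤ._+ coeff l k) (coeff-⊖ (f ⊕ g) h k) ⟨
  coeff (f ⊕ g ⊖ h) k ℤ.+ coeff l k
    ≡⟨ coeff-⊕ (f ⊕ g ⊖ h) l k ⟨
  coeff (f ⊕ g ⊖ h ⊕ l) k ∎
  where
  open ≡-Reasoning
  a = (p ∸ 1) * (p + q ∸ 1)
  b = p * (q ∸ 1)
  c = (p ∸ 1) * (q ∸ 1)
  f = (const 1ℤ ⊕ X) ^ᴾ a
  g = (const 1ℤ ⊕ X) ^ᴾ b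
  h = (const 1ℤ ⊕ X) ^ᴾ c
  l = const (+ (p ∸ 1)) ⊗ X ⊗ (const 1ℤ ⊕ X) ^ᴾ (p * (p ∸ 1))
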